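{- Let $n\ge 2$ and let $\bm{m}=(m_1,\dots,m_n)$ be a vector of integers $m_i\ge 1$. Let $\bm 1_n$ be the all-one vector of length $n$ and let $D(\bm{m})$ be the integral covering graph of $\bm m$. Then \[\dim_{TH}(D(\bm{m}))=\begin{cases} n & \text{if } \bm{m}\ne\bm{1}_n,\\ 0 & \text{if } \bm{m}=\bm{1}_n \text{ and } n=2,\\ n-1 & \text{if } \bm{m}=\bm{1}_n \text{ and } n\ge 3. \end{cases}\]
   Context: $[n]=\{1,\dots,n\}$ and $[m]_0=\{0,1,\dots,m\}$. For $\bm{m}\in\mathbb{Z}_{\ge 1}^n$, the integral covering graph $D(\bm{m})$ has vertex set $\prod_{i=1}^n [m_i]_0\setminus\{\bm{0},\bm{m}\}$, where $\bm 0$ is the all-zero vector, and two distinct vertices $\bm v,\bm w$ are adjacent iff $v_i+w_i\ge m_i$ for all $i\in[n]$. For a finite set $V$, $\alpha\colon V\to\mathbb{R}$ and $S\in\mathbb{R}$, the threshold graph $T(\alpha,S)$ has vertex set $V$ and edges all $\{v,w\}$, $v\neq w$, with $\alpha(v)+\alpha(w)\ge S$; a graph is a threshold graph if it is of this form. The threshold dimension $\dim_{TH}(G)$ of a finite simple graph $G$ is the minimum $d\ge 0$ such that there exist $d$ threshold graphs $H_1,\dots,H_d$ on $V(G)$ with $E(G)=\bigcap_{j=1}^d E(H_j)$; the empty intersection ($d=0$) is the set of all pairs of vertices, so $\dim_{TH}(G)=0$ iff $G$ is complete. -}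

module Defs where

open import Data.Fin.Base using (Fin)
import Data.Integer.Base as ℤ
import Data.Nat.Base as ℕ
open import Data.Nat.Base using (ℕ; suc)
import Data.Nat.Properties as ℕ
import Data.Nat.Solver as ℕSolver
open import Data.Product.Base using (_×_; _,_; ∃; ∃-syntax)
open import Data.Rational.Base using (ℚ; _+_; _-_; _≤_; ∣_∣; _/_; toℚᵘ)
open import Data.Rational.Properties
  using (toℚᵘ-injective; toℚᵘ-homo-+; toℚᵘ-fromℚᵘ; ∣p+q∣≤∣p∣+∣q∣; +-mono-≤; +-comm; module ≤-Reasoning)
import Data.Rational.Solver as ℚSolver
import Data.Rational.Unnormalised.Base as ℚᵘ
import Data.Rational.Unnormalised.Properties as ℚᵘ
open import Data.Vec.Base using (Vec; lookup; replicate)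
open import Function.Bundles using (_⇔_)
open import Level using (0ℓ)
open import Relation.Binary.Core using (Rel)
open import Relation.Binary.Definitions using (Symmetric; Irreflexive)
open import Relation.Binary.PropositionalEquality
  using (_≡_; _≢_; refl; cong; cong₂; ≢-sym)

-- Real numbers, following Bishop: a real is a regular sequence of
-- rationals, |xₘ - xₙ| ≤ 1/(m+1) + 1/(n+1) (indices start at 0).
1/1+ : ℕ → ℚ
1/1+ n = ℤ.+ 1 / suc n

record ℝ : Set where
  constructor mkℝ
  field
    seq     : ℕ → ℚ
    regular : ∀ m n → ∣ seq m - seq n ∣ ≤ 1/1+ m + 1/1+ n

open ℝ public

-- n ↦ 2n+1, so that 1/(2n+2) is half of 1/(n+1).
double : ℕ → ℕ
double n = suc (n ℕ.+ n)

1/1+-double : ∀ n → 1/1+ (double n) + 1/1+ (double n) ≡ 1/1+ n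
1/1+-double n = toℚᵘ-injective (begin
  toℚᵘ (1/1+ k + 1/1+ k)                ≈⟨ toℚᵘ-homo-+ (1/1+ k) (1/1+ k) ⟩
  toℚᵘ (1/1+ k) ℚᵘ.+ toℚᵘ (1/1+ k)      ≈⟨ ℚᵘ.+-cong (toℚᵘ-fromℚᵘ (u k)) (toℚᵘ-fromℚᵘ (u k)) ⟩
  u k ℚᵘ.+ u k                          ≈⟨ ℚᵘ.*≡* (cong ℤ.+_ halves) ⟩
  u n                                   ≈⟨ toℚᵘ-fromℚᵘ (u n) ⟨
  toℚᵘ (1/1+ n)                         ∎)
  where
  open import Relation.Binary.Reasoning.Setoid ℚᵘ.≃-setoid
  k = double n
  u : ℕ → ℚᵘ.ℚᵘ
  u = ℚᵘ.mkℚᵘ (ℤ.+ 1)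
  halves : (1 ℕ.* suc k ℕ.+ 1 ℕ.* suc k) ℕ.* suc n ≡ 1 ℕ.* (suc k ℕ.* suc k)
  halves = solve 1 (λ x →
      let y = con 2 :+ (x :+ x) in
      (con 1 :* y :+ con 1 :* y) :* (con 1 :+ x) := con 1 :* (y :* y)) refl n
    where open ℕSolver.+-*-Solver

infixl 6 _+ℝ_
infix 4 _≤ℝ_ _≥ℝ_

_+ℝ_ : ℝ → ℝ → ℝ
(x +ℝ y) .seq n = seq x (double n) + seq y (double n)
(x +ℝ y) .regular m n = begin
  ∣ (seq x m′ + seq y m′) - (seq x n′ + seq y n′) ∣
    ≡⟨ cong ∣_∣ (solve 4 (λ a b c d → (a :+ b) :- (c :+ d) := (a :- c) :+ (b :- d)) refl
         (seq x m′) (seq y m′) (seq x n′) (seq y n′)) ⟩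
  ∣ (seq x m′ - seq x n′) + (seq y m′ - seq y n′) ∣
    ≤⟨ ∣p+q∣≤∣p∣+∣q∣ (seq x m′ - seq x n′) (seq y m′ - seq y n′) ⟩
  ∣ seq x m′ - seq x n′ ∣ + ∣ seq y m′ - seq y n′ ∣
    ≤⟨ +-mono-≤ (regular x m′ n′) (regular y m′ n′) ⟩
  (1/1+ m′ + 1/1+ n′) + (1/1+ m′ + 1/1+ n′)
    ≡⟨ solve 2 (λ a b → (a :+ b) :+ (a :+ b) := (a :+ a) :+ (b :+ b)) refl (1/1+ m′) (1/1+ n′) ⟩
  (1/1+ m′ + 1/1+ m′) + (1/1+ n′ + 1/1+ n′)
    ≡⟨ cong₂ _+_ (1/1+-double m) (1/1+-double n) ⟩
  1/1+ m + 1/1+ n ∎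
  where
  open ≤-Reasoning
  open ℚSolver.+-*-Solver
  m′ = double m
  n′ = double n

-- Each term is within 1/(n+1) of the real it approximates, hence the
-- error of 2/(n+1) when comparing two sequences.
_≤ℝ_ : Rel ℝ 0ℓ
x ≤ℝ y = ∀ n → seq x n ≤ seq y n + (1/1+ n + 1/1+ n)

_≥ℝ_ : Rel ℝ 0ℓ
x ≥ℝ y = y ≤ℝ x

+ℝ-comm-≤ : ∀ {s} x y → s ≤ℝ x +ℝ y → s ≤ℝ y +ℝ x
+ℝ-comm-≤ {s} x y s≤ n = begin
  seq s n                            ≤⟨ s≤ n ⟩
  seq (x +ℝ y) n + (1/1+ n + 1/1+ n)  ≡⟨ cong (_+ (1/1+ n + 1/1+ n)) (+-comm (seq x (double n)) (seq y (double n))) ⟩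
  seq (y +ℝ x) n + (1/1+ n + 1/1+ n)  ∎
  where
  open ≤-Reasoning

record SimpleGraph (V : Set) : Set₁ where
  field
    Adj    : Rel V 0ℓ
    sym    : Symmetric Adj
    irrefl : Irreflexive _≡_ Adj

open SimpleGraph public using (Adj)

thresholdGraph : {V : Set} → (V → ℝ) → ℝ → SimpleGraph V
thresholdGraph α S = record
  { Adj    = λ v w → v ≢ w × α v +ℝ α w ≥ℝ S
  ; sym    = λ {v} {w} (v≢w , S≤) → ≢-sym v≢w , +ℝ-comm-≤ {S} (α v) (α w) S≤
  ; irrefl = λ v≡w (v≢w , _) → v≢w v≡w
  }

infix 4 _≈ᴳ_

_≈ᴳ_ : {V : Set} → SimpleGraph V → SimpleGraph V → Set
G ≈ᴳ H = ∀ v w → Adj G v w ⇔ Adj H v w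

IsThreshold : {V : Set} → SimpleGraph V → Set
IsThreshold {V} H = ∃[ α ] ∃[ S ] H ≈ᴳ thresholdGraph {V} α S

-- The guard v ≢ w makes the empty intersection (d = 0) the set of all
-- pairs of distinct vertices.
IsThresholdIntersection : {V : Set} → SimpleGraph V → ℕ → Set₁
IsThresholdIntersection {V} G d =
  ∃ λ (H : Fin d → SimpleGraph V) →
    (∀ j → IsThreshold (H j)) ×
    (∀ v w → v ≢ w → Adj G v w ⇔ (∀ j → Adj (H j) v w))

-- dim-TH G ≔ d says that the minimum defining the threshold dimension
-- of G exists and equals d.
infix 4 dim-TH_≔_

dim-TH_≔_ : {V : Set} → SimpleGraph V → ℕ → Set₁
dim-TH G ≔ d =
  IsThresholdIntersection G d ×
  (∀ e → IsThresholdIntersection G e → d ℕ.≤ e)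

-- The conditions are irrelevant, so that vertices with the same
-- coordinates are equal.
record Vertex {n : ℕ} (m : Vec ℕ n) : Set where
  constructor vertex
  field
    coords   : Vec ℕ n
    .bounded : ∀ i → lookup coords i ℕ.≤ lookup m i
    .≢𝟎      : coords ≢ replicate n 0
    .≢m      : coords ≢ m

open Vertex public using (coords)

D : {n : ℕ} (m : Vec ℕ n) → SimpleGraph (Vertex m)
D m = record
  { Adj    = λ v w → v ≢ w ×
               (∀ i → lookup (coords v) i ℕ.+ lookup (coords w) i ℕ.≥ lookup m i)
  ; sym    = λ {v} {w} (v≢w , v+w≥m) → ≢-sym v≢w , λ i →
               ℕ.≤-trans (v+w≥m i)
                 (ℕ.≤-reflexive (ℕ.+-comm (lookup (coords v) i) (lookup (coords w) i)))
  ; irrefl = λ v≡w (v≢w , _) → v≢w v≡w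
  }

{-# OPTIONS --safe #-}

-- If {a,b} and {c,d} are non-edges of G while ac and bd are edges, then no
-- threshold graph containing G omits both ab and cd, since
-- α(a) + α(b) + α(c) + α(d) would be both < 2S and ≥ 2S. Hence d pairwise
-- conflicting non-edges force dimension at least d. Under v ↦ m - v, adjacency
-- becomes v + w ≤ m, and the non-edges {mᵢeᵢ, eᵢ + eₚ} with i ≠ p conflict
-- pairwise; if mₚ ≥ 2, so does the further one {mₚeₚ, eₚ}.
-- The reals being constructive, the omitted edges are only found up to double
-- negation, which suffices because d ≤ e is decidable.
module Submission where

open import Defs
open import Data.Nat.Base using (ℕ; _≤_; _∸_)
open import Data.Product.Base using (_×_)
open import Data.Vec.Base using (Vec; lookup; replicate)
open import Relation.Binary.PropositionalEquality using (_≡_; _≢_)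

open import Data.Empty using (⊥; ⊥-elim-irr)
open import Data.Fin.Base using (Fin; zero; suc; punchIn)
import Data.Fin.Properties as Fin
import Data.Integer.Base as ℤ
open import Data.Integer.Base using (+[1+_]; -[1+_])
import Data.Integer.Properties as ℤ
open import Data.Nat.Base using (zero; suc; _+_; _*_; _<_; pred; z≤n; s≤s; s≤s⁻¹)
import Data.Nat.Properties as ℕ
open import Data.Nat.Solver using (module +-*-Solver)
open import Data.Product.Base using (_,_; ∃-syntax; proj₁; proj₂)
import Data.Rational.Base as ℚ
open import Data.Rational.Base using (0ℚ; 1ℚ; mkℚ)
import Data.Rational.Properties as ℚ
import Data.Rational.Solver as ℚSolver
import Data.Rational.Unnormalised.Base as ℚᵘ
import Data.Rational.Unnormalised.Properties as ℚᵘ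
open import Data.Sum.Base using (_⊎_; inj₁; inj₂)
open import Data.Vec.Base using ([]; _∷_; _[_]≔_)
import Data.Vec.Properties as Vec
open import Effect.Monad using (RawMonad)
open import Function.Base using (id; _∘_)
open import Function.Bundles using (_⇔_; mk⇔; module Equivalence)
open import Relation.Binary.PropositionalEquality
  using (refl; sym; trans; cong; cong₂; subst; subst₂; ≢-sym; respˡ; respʳ)
open import Relation.Nullary using (¬_; yes; no; contradiction; recompute)
open import Relation.Nullary.Negation using (DoubleNegation; ¬¬-Monad)
open import Algebra.Properties.Monoid.Mult ℚ.+-0-monoid
  using (×-homo-+) renaming (_×_ to _·_)
open Equivalence using (to; from)

-- Estimates for rationals and Bishop reals.

p≤∣p∣ : ∀ p → p ℚ.≤ ℚ.∣ p ∣
p≤∣p∣ (mkℚ (ℤ.+ _) _ _)    = ℚ.≤-refl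
p≤∣p∣ p@(mkℚ -[1+ _ ] _ _) = ℚ.≤-trans (ℚ.<⇒≤ (ℚ.negative⁻¹ p)) (ℚ.0≤∣p∣ p)

∣p-q∣≤r⇒p≤q+r : ∀ p q {r} → ℚ.∣ p ℚ.- q ∣ ℚ.≤ r → p ℚ.≤ q ℚ.+ r
∣p-q∣≤r⇒p≤q+r p q {r} ∣p-q∣≤r = begin
  p                      ≡⟨ solve 2 (λ p q → p := q :+ (p :- q)) refl p q ⟩
  q ℚ.+ (p ℚ.- q)        ≤⟨ ℚ.+-monoʳ-≤ q (ℚ.≤-trans (p≤∣p∣ (p ℚ.- q)) ∣p-q∣≤r) ⟩
  q ℚ.+ r                ∎
  where
  open ℚ.≤-Reasoning
  open ℚSolver.+-*-Solver

-- The denominator of p itself serves: a positive numerator is at least 1.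
archimedean : ∀ {p} → 0ℚ ℚ.< p → ∃[ n ] 1/1+ n ℚ.≤ p
archimedean {mkℚ +[1+ a ] d c} _ = d , ℚ.toℚᵘ-cancel-≤ (begin
  ℚ.toℚᵘ (1/1+ d)     ≃⟨ ℚ.toℚᵘ-fromℚᵘ (ℚᵘ.mkℚᵘ (ℤ.+ 1) d) ⟩
  ℚᵘ.mkℚᵘ (ℤ.+ 1) d   ≤⟨ ℚᵘ.*≤* (ℤ.*-monoʳ-≤-nonNeg ℤ.+[1+ d ] (ℤ.+≤+ (s≤s (z≤n {a})))) ⟩
  ℚᵘ.mkℚᵘ +[1+ a ] d  ∎)
  where open ℚᵘ.≤-Reasoning
archimedean {mkℚ (ℤ.+ 0) _ _} 0<p = contradiction (ℚ.positive 0<p) λ ()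
archimedean {mkℚ -[1+ _ ] _ _} 0<p = contradiction (ℚ.positive 0<p) λ ()

-- A failure of x ≤ y at one index yields, by regularity, a gap at every index.
≰ℝ⇒gap : ∀ x y → ¬ x ≤ℝ y → DoubleNegation
  (∃[ ε ] 0ℚ ℚ.< ε × (∀ k → seq y k ℚ.+ ε ℚ.≤ seq x k ℚ.+ (1/1+ k ℚ.+ 1/1+ k)))
≰ℝ⇒gap x y x≰y ¬gap = x≰y λ n → ℚ.≮⇒≥ λ yₙ<xₙ → ¬gap (gap n yₙ<xₙ)
  where
  open ℚSolver.+-*-Solver
  open ℚ.≤-Reasoning

  gap : ∀ n → seq y n ℚ.+ (1/1+ n ℚ.+ 1/1+ n) ℚ.< seq x n → _
  gap n yₙ<xₙ = ε , 0<ε , λ k → begin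
    seq y k ℚ.+ ε
      ≤⟨ ℚ.+-monoˡ-≤ ε (∣p-q∣≤r⇒p≤q+r (seq y k) (seq y n) (regular y k n)) ⟩
    seq y n ℚ.+ (1/1+ k ℚ.+ 1/1+ n) ℚ.+ ε
      ≡⟨ solve 4 (λ x y a b → y :+ (a :+ b) :+ (x :- (y :+ (b :+ b))) := x :+ (a :- b)) refl
           (seq x n) (seq y n) (1/1+ k) (1/1+ n) ⟩
    seq x n ℚ.+ (1/1+ k ℚ.- 1/1+ n)
      ≤⟨ ℚ.+-monoˡ-≤ (1/1+ k ℚ.- 1/1+ n) (∣p-q∣≤r⇒p≤q+r (seq x n) (seq x k) (regular x n k)) ⟩
    seq x k ℚ.+ (1/1+ n ℚ.+ 1/1+ k) ℚ.+ (1/1+ k ℚ.- 1/1+ n)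
      ≡⟨ solve 3 (λ x a b → x :+ (b :+ a) :+ (a :- b) := x :+ (a :+ a)) refl
           (seq x k) (1/1+ k) (1/1+ n) ⟩
    seq x k ℚ.+ (1/1+ k ℚ.+ 1/1+ k) ∎
    where
    t = seq y n ℚ.+ (1/1+ n ℚ.+ 1/1+ n)
    ε = seq x n ℚ.- t
    0<ε : 0ℚ ℚ.< ε
    0<ε = begin-strict
      0ℚ             ≡⟨ ℚ.+-inverseʳ t ⟨
      t ℚ.- t        <⟨ ℚ.+-monoˡ-< (ℚ.- t) yₙ<xₙ ⟩
      seq x n ℚ.- t  ∎

-- Adding the gaps ε and δ to the two upper estimates of s gives T + ε + δ ≤ T + 8e at index k,
-- where e is `1/1+ k`. The goal is ⊥, so both doubly negated gaps may be opened.
no-crossing : ∀ {s} a b c d → s ≤ℝ a +ℝ c → s ≤ℝ b +ℝ d →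
  ¬ s ≤ℝ a +ℝ b → ¬ s ≤ℝ c +ℝ d → ⊥
no-crossing {s} a b c d s≤ac s≤bd s≰ab s≰cd =
  ≰ℝ⇒gap s (a +ℝ b) s≰ab λ (ε , 0<ε , gap) →
  ≰ℝ⇒gap s (c +ℝ d) s≰cd λ (δ , 0<δ , gap′) →
  let
    (n , 1/n≤ε) = archimedean 0<ε
    -- Each doubling halves the error, so after three of them 8e equals `1/1+ n`, which is at most
    -- ε.
    n₁ = double n
    n₂ = double n₁
    k = double n₂
    e = 1/1+ k
    A = seq a (double k)
    B = seq b (double k)
    C = seq c (double k)
    D′ = seq d (double k)
    T = (A ℚ.+ B) ℚ.+ (C ℚ.+ D′)
  in ℚ.<-irrefl refl (begin-strict
    T ℚ.+ ε
      ≡⟨ cong (T ℚ.+_) (ℚ.+-identityʳ ε) ⟨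
    T ℚ.+ (ε ℚ.+ 0ℚ)
      <⟨ ℚ.+-monoʳ-< T (ℚ.+-monoʳ-< ε 0<δ) ⟩
    T ℚ.+ (ε ℚ.+ δ)
      ≡⟨ solve 4 (λ x y u v → (x :+ y) :+ (u :+ v) := (x :+ u) :+ (y :+ v)) refl
           (A ℚ.+ B) (C ℚ.+ D′) ε δ ⟩
    ((A ℚ.+ B) ℚ.+ ε) ℚ.+ ((C ℚ.+ D′) ℚ.+ δ)
      ≤⟨ ℚ.+-mono-≤ (gap k) (gap′ k) ⟩
    (seq s k ℚ.+ (e ℚ.+ e)) ℚ.+ (seq s k ℚ.+ (e ℚ.+ e))
      ≤⟨ ℚ.+-mono-≤ (ℚ.+-monoˡ-≤ (e ℚ.+ e) (s≤ac k)) (ℚ.+-monoˡ-≤ (e ℚ.+ e) (s≤bd k)) ⟩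
    ((A ℚ.+ C) ℚ.+ (e ℚ.+ e) ℚ.+ (e ℚ.+ e)) ℚ.+ ((B ℚ.+ D′) ℚ.+ (e ℚ.+ e) ℚ.+ (e ℚ.+ e))
      ≡⟨ solve 5 (λ a b c d f → ((a :+ c) :+ f :+ f) :+ ((b :+ d) :+ f :+ f)
           := ((a :+ b) :+ (c :+ d)) :+ ((f :+ f) :+ (f :+ f))) refl A B C D′ (e ℚ.+ e) ⟩
    T ℚ.+ (((e ℚ.+ e) ℚ.+ (e ℚ.+ e)) ℚ.+ ((e ℚ.+ e) ℚ.+ (e ℚ.+ e)))
      ≡⟨ cong (λ f → T ℚ.+ ((f ℚ.+ f) ℚ.+ (f ℚ.+ f))) (1/1+-double n₂) ⟩
    T ℚ.+ ((1/1+ n₂ ℚ.+ 1/1+ n₂) ℚ.+ (1/1+ n₂ ℚ.+ 1/1+ n₂))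
      ≡⟨ cong (λ f → T ℚ.+ (f ℚ.+ f)) (1/1+-double n₁) ⟩
    T ℚ.+ (1/1+ n₁ ℚ.+ 1/1+ n₁)
      ≡⟨ cong (T ℚ.+_) (1/1+-double n) ⟩
    T ℚ.+ 1/1+ n
      ≤⟨ ℚ.+-monoʳ-≤ T 1/n≤ε ⟩
    T ℚ.+ ε ∎)
  where
  open ℚSolver.+-*-Solver
  open ℚ.≤-Reasoning

-- Natural numbers as reals.

·1-mono-≤ : ∀ {m n} → m ≤ n → m · 1ℚ ℚ.≤ n · 1ℚ
·1-mono-≤ {n = zero}  z≤n       = ℚ.≤-refl
·1-mono-≤ {n = suc n} z≤n       =
  ℚ.+-mono-≤ (ℚ.nonNegative⁻¹ 1ℚ) (·1-mono-≤ {n = n} z≤n)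
·1-mono-≤ (s≤s m≤n) = ℚ.+-monoʳ-≤ 1ℚ (·1-mono-≤ m≤n)

0≤1/1+ : ∀ n → 0ℚ ℚ.≤ 1/1+ n
0≤1/1+ n = ℚ.nonNegative⁻¹ (1/1+ n) {{ℚ.normalize-nonNeg 1 (suc n)}}

fromℕ : ℕ → ℝ
fromℕ k = mkℝ (λ _ → k · 1ℚ) λ m n → begin
  ℚ.∣ k · 1ℚ ℚ.- k · 1ℚ ∣  ≡⟨ cong ℚ.∣_∣ (ℚ.+-inverseʳ (k · 1ℚ)) ⟩
  0ℚ                       ≤⟨ ℚ.+-mono-≤ (0≤1/1+ m) (0≤1/1+ n) ⟩
  1/1+ m ℚ.+ 1/1+ n        ∎
  where
  open ℚ.≤-Reasoning

fromℕ-≤-+ : ∀ {s x y} → s ≤ x + y → fromℕ s ≤ℝ fromℕ x +ℝ fromℕ y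
fromℕ-≤-+ {s} {x} {y} s≤x+y n = begin
  s · 1ℚ                                             ≤⟨ ·1-mono-≤ s≤x+y ⟩
  (x + y) · 1ℚ                                       ≡⟨ ×-homo-+ 1ℚ x y ⟩
  x · 1ℚ ℚ.+ y · 1ℚ                                  ≡⟨ ℚ.+-identityʳ _ ⟨
  x · 1ℚ ℚ.+ y · 1ℚ ℚ.+ 0ℚ
    ≤⟨ ℚ.+-monoʳ-≤ (x · 1ℚ ℚ.+ y · 1ℚ) (ℚ.+-mono-≤ (0≤1/1+ n) (0≤1/1+ n)) ⟩
  x · 1ℚ ℚ.+ y · 1ℚ ℚ.+ (1/1+ n ℚ.+ 1/1+ n)          ∎
  where
  open ℚ.≤-Reasoning

-- Index 2 decides the matter: the slack allowed by `_≤ℝ_` is 2/3 there, less than the distance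
-- between distinct naturals.
fromℕ-≤-+⁻¹ : ∀ {s x y} → fromℕ s ≤ℝ fromℕ x +ℝ fromℕ y → s ≤ x + y
fromℕ-≤-+⁻¹ {s} {x} {y} s≤ = ℕ.≮⇒≥ λ x+y<s → ℚ.<-irrefl refl (begin-strict
  x · 1ℚ ℚ.+ y · 1ℚ ℚ.+ (1/1+ 2 ℚ.+ 1/1+ 2)
    <⟨ ℚ.+-monoʳ-< (x · 1ℚ ℚ.+ y · 1ℚ) (ℚ.*<* (ℤ.+<+ (s≤s (s≤s (s≤s z≤n))))) ⟩
  x · 1ℚ ℚ.+ y · 1ℚ ℚ.+ 1ℚ    ≡⟨ cong (ℚ._+ 1ℚ) (×-homo-+ 1ℚ x y) ⟨
  (x + y) · 1ℚ ℚ.+ 1ℚ         ≡⟨ ℚ.+-comm ((x + y) · 1ℚ) 1ℚ ⟩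
  suc (x + y) · 1ℚ            ≤⟨ ·1-mono-≤ x+y<s ⟩
  s · 1ℚ                      ≤⟨ s≤ 2 ⟩
  x · 1ℚ ℚ.+ y · 1ℚ ℚ.+ (1/1+ 2 ℚ.+ 1/1+ 2) ∎)
  where open ℚ.≤-Reasoning

-- Alternating 4-cycles and the conflict bound.

-- Since a ≢ b and c ≢ d, the two non-edges can only be due to weight sums that fail to reach S,
-- which is what `no-crossing` excludes.
threshold-no-alternating-cycle : ∀ {V} {H : SimpleGraph V} → IsThreshold H →
  ∀ {a b c d} → a ≢ b → c ≢ d → ¬ Adj H a b → ¬ Adj H c d →
  Adj H a c → Adj H b d → ⊥
threshold-no-alternating-cycle {H = H} (α , S , H≈) {a} {b} {c} {d} a≢b c≢d ¬ab ¬cd ac bd =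
  no-crossing {S} (α a) (α b) (α c) (α d)
    (proj₂ (to (H≈ a c) ac)) (proj₂ (to (H≈ b d) bd))
    (λ s≤ → ¬ab (from (H≈ a b) (a≢b , s≤)))
    (λ s≤ → ¬cd (from (H≈ c d) (c≢d , s≤)))

-- Double negation commutes with finite conjunctions, so P need not be decidable.
¬∀⇒¬¬∃¬ : ∀ {n} {P : Fin n → Set} → ¬ (∀ i → P i) → DoubleNegation (∃[ i ] ¬ P i)
¬∀⇒¬¬∃¬ ¬∀P ¬∃¬P = ¬¬∀ ¬∀P
  where ¬¬∀ = Fin.sequence (RawMonad.rawApplicative ¬¬-Monad) (λ i ¬Pi → ¬∃¬P (i , ¬Pi))

-- Non-edges are unordered pairs, so either matching between them may close the alternating 4-cycle.
Conflict : {V : Set} → SimpleGraph V → (a b c d : V) → Set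
Conflict G a b c d = (Adj G a c × Adj G b d) ⊎ (Adj G a d × Adj G b c)

-- Each non-edge is omitted by some `H j`. If e < d, the pigeonhole principle makes one factor omit
-- two conflicting non-edges.
conflict-bound : ∀ {V} (G : SimpleGraph V) {d} (a b : Fin d → V) →
  (∀ i → a i ≢ b i) → (∀ i → ¬ Adj G (a i) (b i)) →
  (∀ {i j} → i ≢ j → Conflict G (a i) (b i) (a j) (b j)) →
  ∀ e → IsThresholdIntersection G e → d ≤ e
conflict-bound G a b a≢b ¬ab conflict e (H , threshold , G⇔) = ℕ.≮⇒≥ λ e<d →
  Fin.sequence (RawMonad.rawApplicative ¬¬-Monad)
    (λ i → ¬∀⇒¬¬∃¬ (¬ab i ∘ from (G⇔ (a i) (b i) (a≢b i))))
    λ omit → collide e<d (proj₁ ∘ omit) (proj₂ ∘ omit)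
  where
  lift : ∀ {v w} → Adj G v w → ∀ j → Adj (H j) v w
  lift {v} {w} vw = to (G⇔ v w (λ v≡w → SimpleGraph.irrefl G v≡w vw)) vw
  collide : e < _ → (f : _ → Fin e) → (∀ i → ¬ Adj (H (f i)) (a i) (b i)) → ⊥
  collide e<d f ¬Hab with Fin.pigeonhole e<d f
  ... | i , j , i<j , fi≡fj with conflict (Fin.<⇒≢ i<j)
  ...   | inj₁ (ac , bd) = threshold-no-alternating-cycle {H = H (f i)} (threshold (f i))
            (a≢b i) (a≢b j) (¬Hab i) (subst (λ h → ¬ Adj (H h) (a j) (b j)) (sym fi≡fj) (¬Hab j))
            (lift ac (f i)) (lift bd (f i))
  -- The other matching is the first case with the second non-edge reversed.
  ...   | inj₂ (ad , bc) = threshold-no-alternating-cycle {H = H (f i)} (threshold (f i))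
            (a≢b i) (≢-sym (a≢b j)) (¬Hab i)
            (subst (λ h → ¬ Adj (H h) (a j) (b j)) (sym fi≡fj) (¬Hab j) ∘ SimpleGraph.sym (H (f i)))
            (lift ad (f i)) (lift bc (f i))

-- Upper bounds from natural-number weights.

ℕ-threshold-intersection : ∀ {V} (G : SimpleGraph V) {d} (α : Fin d → V → ℕ) (S : Fin d → ℕ) →
  (∀ {v w} → v ≢ w → Adj G v w ⇔ (∀ j → S j ≤ α j v + α j w)) →
  IsThresholdIntersection G d
ℕ-threshold-intersection G α S G⇔ =
  (λ j → thresholdGraph (fromℕ ∘ α j) (fromℕ (S j))) ,
  (λ j → fromℕ ∘ α j , fromℕ (S j) , λ v w → mk⇔ id id) ,
  λ v w v≢w → mk⇔
    (λ vw j → v≢w , fromℕ-≤-+ {S j} {α j v} {α j w} (to (G⇔ v≢w) vw j))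
    (λ vw → from (G⇔ v≢w) λ j → fromℕ-≤-+⁻¹ {S j} {α j v} {α j w} (proj₂ (vw j)))

-- Each coordinate is itself a weight, with threshold mᵢ.
D-threshold-intersection : ∀ {n} (m : Vec ℕ n) → IsThresholdIntersection (D m) n
D-threshold-intersection m = ℕ-threshold-intersection (D m) (λ i v → lookup (coords v) i) (lookup m)
  λ v≢w → mk⇔ proj₂ (v≢w ,_)

lookup-ext : ∀ {n} {xs ys : Vec ℕ n} → (∀ i → lookup xs i ≡ lookup ys i) → xs ≡ ys
lookup-ext {xs = xs} {ys} eq =
  trans (sym (Vec.tabulate∘lookup xs)) (trans (Vec.tabulate-cong eq) (Vec.tabulate∘lookup ys))

coords-injective : ∀ {n} {m : Vec ℕ n} {v w : Vertex m} → coords v ≡ coords w → v ≡ w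
coords-injective refl = refl

-- The bound is stored irrelevantly; decidability of ≤ recovers a usable proof.
lookup≤ : ∀ {n} {m : Vec ℕ n} (v : Vertex m) i → lookup (coords v) i ≤ lookup m i
lookup≤ (vertex c c≤m _ _) i = recompute (_ ℕ.≤? _) (c≤m i)

lookup≤1 : ∀ {n} (v : Vertex (replicate n 1)) i → lookup (coords v) i ≤ 1
lookup≤1 v i = respʳ _≤_ (Vec.lookup-replicate i 1) (lookup≤ v i)

-- Coordinate 0 can be shared among the other coordinates: when v₀ = w₀ = 0 and
-- v ≠ w, some other coordinate has vᵢ + wᵢ ≤ 1, so 2(vᵢ + wᵢ) + v₀ + w₀ < 3.
D-𝟏-threshold-intersection : ∀ n → IsThresholdIntersection (D (replicate (suc n) 1)) n
D-𝟏-threshold-intersection n = ℕ-threshold-intersection (D (replicate (suc n) 1))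
  (λ j v → 2 * lookup (coords v) (suc j) + lookup (coords v) zero) (λ _ → 3)
  λ {v} {w} v≢w → mk⇔
    (λ (_ , vw) j → sufficient
       (lookup (coords v) (suc j)) (lookup (coords w) (suc j))
       (respˡ _≤_ (Vec.lookup-replicate j 1) (vw (suc j))) (vw zero))
    (λ vw → v≢w , λ where
      zero    → ℕ.≮⇒≥ λ v₀+w₀<1 →
        let
          v₀+w₀≡0 = ℕ.n<1⇒n≡0 v₀+w₀<1
          v₀≡0 = ℕ.m+n≡0⇒m≡0 (lookup (coords v) zero) v₀+w₀≡0
          w₀≡0 = ℕ.m+n≡0⇒n≡0 (lookup (coords v) zero) v₀+w₀≡0
        in v≢w (coords-injective (lookup-ext λ where
          zero    → trans v₀≡0 (sym w₀≡0)
          (suc j) → equal {lookup (coords v) (suc j)} {lookup (coords w) (suc j)} v₀≡0 w₀≡0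
                      (lookup≤1 v (suc j)) (lookup≤1 w (suc j)) (vw j)))
      (suc j) → respˡ _≤_ (sym (Vec.lookup-replicate j 1))
                  (positive (lookup (coords v) (suc j)) {lookup (coords w) (suc j)}
                     (lookup≤1 v zero) (lookup≤1 w zero) (vw j)))
  where
  sufficient : ∀ x y {p q} → 1 ≤ x + y → 1 ≤ p + q → 3 ≤ (2 * x + p) + (2 * y + q)
  sufficient x y {p} {q} 1≤x+y 1≤p+q = begin
    3                          ≤⟨ ℕ.+-mono-≤ (ℕ.*-monoʳ-≤ 2 1≤x+y) 1≤p+q ⟩
    2 * (x + y) + (p + q)      ≡⟨ solve 4 (λ x y p q → con 2 :* (x :+ y) :+ (p :+ q)
                                    := (con 2 :* x :+ p) :+ (con 2 :* y :+ q)) refl x y p q ⟩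
    (2 * x + p) + (2 * y + q)  ∎
    where
    open ℕ.≤-Reasoning
    open +-*-Solver
  -- With x = y = 0 only p + q ≤ 2 remains, short of the threshold 3.
  positive : ∀ x {y p q} → p ≤ 1 → q ≤ 1 → 3 ≤ (2 * x + p) + (2 * y + q) → 1 ≤ x + y
  positive (suc x)             _   _   _   = s≤s z≤n
  positive zero    {y = suc y} _   _   _   = s≤s z≤n
  positive zero    {y = zero}  p≤1 q≤1 3≤  =
    contradiction (ℕ.≤-trans 3≤ (ℕ.+-mono-≤ p≤1 q≤1)) λ { (s≤s (s≤s ())) }
  equal : ∀ {x y p q} → p ≡ 0 → q ≡ 0 → x ≤ 1 → y ≤ 1 → 3 ≤ (2 * x + p) + (2 * y + q) → x ≡ y
  equal refl refl z≤n       z≤n       ()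
  equal refl refl z≤n       (s≤s z≤n) (s≤s (s≤s ()))
  equal refl refl (s≤s z≤n) z≤n       (s≤s (s≤s ()))
  equal refl refl (s≤s z≤n) (s≤s z≤n) _ = refl

-- The only vertices are (0,1) and (1,0), whose sum is (1,1).
D-1-1-complete : ∀ {v w : Vertex (1 ∷ 1 ∷ [])} → v ≢ w → Adj (D (1 ∷ 1 ∷ [])) v w
D-1-1-complete {v} {w} v≢w = v≢w , adjacent (shape v) (shape w)
  where
  shape : (v : Vertex (1 ∷ 1 ∷ [])) → coords v ≡ 0 ∷ 1 ∷ [] ⊎ coords v ≡ 1 ∷ 0 ∷ []
  shape v@(vertex (x ∷ y ∷ []) _ ≢𝟎 ≢m) = cases (lookup≤ v zero) (lookup≤ v (suc zero)) ≢𝟎 ≢m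
    where
    cases : ∀ {x y} → x ≤ 1 → y ≤ 1 → .(x ∷ y ∷ [] ≢ 0 ∷ 0 ∷ []) → .(x ∷ y ∷ [] ≢ 1 ∷ 1 ∷ []) →
      x ∷ y ∷ [] ≡ 0 ∷ 1 ∷ [] ⊎ x ∷ y ∷ [] ≡ 1 ∷ 0 ∷ []
    cases z≤n       z≤n       ≢𝟎 _  = ⊥-elim-irr (≢𝟎 refl)
    cases z≤n       (s≤s z≤n) _  _  = inj₁ refl
    cases (s≤s z≤n) z≤n       _  _  = inj₂ refl
    cases (s≤s z≤n) (s≤s z≤n) _  ≢m = ⊥-elim-irr (≢m refl)
  adjacent : coords v ≡ 0 ∷ 1 ∷ [] ⊎ coords v ≡ 1 ∷ 0 ∷ [] →
    coords w ≡ 0 ∷ 1 ∷ [] ⊎ coords w ≡ 1 ∷ 0 ∷ [] →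
    ∀ i → lookup (1 ∷ 1 ∷ []) i ≤ lookup (coords v) i + lookup (coords w) i
  adjacent (inj₁ v≡) (inj₁ w≡) _ = contradiction (coords-injective (trans v≡ (sym w≡))) v≢w
  adjacent (inj₂ v≡) (inj₂ w≡) _ = contradiction (coords-injective (trans v≡ (sym w≡))) v≢w
  adjacent (inj₁ v≡) (inj₂ w≡) i rewrite v≡ | w≡ with i
  ... | zero     = s≤s z≤n
  ... | suc zero = s≤s z≤n
  adjacent (inj₂ v≡) (inj₁ w≡) i rewrite v≡ | w≡ with i
  ... | zero     = s≤s z≤n
  ... | suc zero = s≤s z≤n

-- The conflicting non-edges.

-- In b p the second update overwrites the first, so that b p = m - eₚ.
module NonEdges {n} (m : Vec ℕ n) (1≤m : ∀ i → 1 ≤ lookup m i) (p : Fin n) where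

  m⁻ : Vec ℕ n
  m⁻ = m [ p ]≔ pred (lookup m p)

  -- Under v ↦ m - v these are mᵢeᵢ and, for i ≠ p, eᵢ + eₚ.
  a b : Fin n → Vec ℕ n
  a i = m [ i ]≔ 0
  b i = m⁻ [ i ]≔ pred (lookup m i)

  aᵢ[i] : ∀ i → lookup (a i) i ≡ 0
  aᵢ[i] i = Vec.lookup∘update i m 0

  aᵢ[k] : ∀ {i k} → k ≢ i → lookup (a i) k ≡ lookup m k
  aᵢ[k] k≢i = Vec.lookup∘update′ k≢i m 0

  bᵢ[i] : ∀ i → lookup (b i) i ≡ pred (lookup m i)
  bᵢ[i] i = Vec.lookup∘update i m⁻ (pred (lookup m i))

  bᵢ[p] : ∀ i → lookup (b i) p ≡ pred (lookup m p)
  bᵢ[p] i with p Fin.≟ i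
  ... | yes refl = bᵢ[i] i
  ... | no  p≢i  = trans (Vec.lookup∘update′ p≢i m⁻ (pred (lookup m i)))
                     (Vec.lookup∘update p m (pred (lookup m p)))

  bᵢ[k] : ∀ {i k} → k ≢ i → k ≢ p → lookup (b i) k ≡ lookup m k
  bᵢ[k] {i} k≢i k≢p = trans (Vec.lookup∘update′ k≢i m⁻ (pred (lookup m i)))
                     (Vec.lookup∘update′ k≢p m (pred (lookup m p)))

  pred-m< : ∀ i → pred (lookup m i) < lookup m i
  pred-m< i with suc x ← lookup m i | _ ← 1≤m i = ℕ.n<1+n x

  a≤m : ∀ i k → lookup (a i) k ≤ lookup m k
  a≤m i k with k Fin.≟ i
  ... | yes refl = respˡ _≤_ (sym (aᵢ[i] k)) z≤n
  ... | no  k≢i  = ℕ.≤-reflexive (aᵢ[k] k≢i)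

  b≤m : ∀ i k → lookup (b i) k ≤ lookup m k
  b≤m i k with k Fin.≟ i | k Fin.≟ p
  ... | yes refl | _        = respˡ _≤_ (sym (bᵢ[i] k)) ℕ.pred[n]≤n
  ... | no _     | yes refl = respˡ _≤_ (sym (bᵢ[p] i)) ℕ.pred[n]≤n
  ... | no k≢i   | no k≢p   = ℕ.≤-reflexive (bᵢ[k] k≢i k≢p)

  ≢-at : ∀ {xs ys : Vec ℕ n} k → lookup xs k < lookup ys k → xs ≢ ys
  ≢-at k x<y refl = ℕ.<-irrefl refl x<y

  ≢𝟎-at : ∀ {xs : Vec ℕ n} k → 1 ≤ lookup xs k → xs ≢ replicate n 0
  ≢𝟎-at k 1≤x = ≢-sym (≢-at k (respˡ _<_ (sym (Vec.lookup-replicate k 0)) 1≤x))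

  aᵢ<m : ∀ i → lookup (a i) i < lookup m i
  aᵢ<m i = respˡ _<_ (sym (aᵢ[i] i)) (1≤m i)

  bᵢ<m : ∀ i → lookup (b i) i < lookup m i
  bᵢ<m i = respˡ _<_ (sym (bᵢ[i] i)) (pred-m< i)

  -- The index k witnesses that `a i` is nonzero, since the entry mₖ ≥ 1 survives there.
  aᵛ : ∀ {i k} → k ≢ i → Vertex m
  aᵛ {i} {k} k≢i = vertex (a i) (a≤m i)
    (≢𝟎-at k (subst (1 ≤_) (sym (aᵢ[k] k≢i)) (1≤m k))) (≢-at i (aᵢ<m i))

  -- The positive entry is left to the caller: it is at p when mₚ ≥ 2, and at a third coordinate
  -- when m is all ones.
  bᵛ : ∀ {i k} → 1 ≤ lookup (b i) k → Vertex m
  bᵛ {i} {k} 1≤ = vertex (b i) (b≤m i) (≢𝟎-at k 1≤) (≢-at i (bᵢ<m i))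

  -- For i ≠ p the vectors differ at p, by mₚ against mₚ - 1. For i = p they are 0 and mₚ - 1 there,
  -- which differ once mₚ ≥ 2.
  a≢b : ∀ i → i ≢ p ⊎ 2 ≤ lookup m p → a i ≢ b i
  a≢b i (inj₁ i≢p) = ≢-sym (≢-at p (subst₂ _<_ (sym (bᵢ[p] i)) (sym (aᵢ[k] (≢-sym i≢p))) (pred-m< p)))
  a≢b i (inj₂ 2≤mₚ) with i Fin.≟ p
  ... | yes refl = ≢-at i (subst₂ _<_ (sym (aᵢ[i] i)) (sym (bᵢ[i] i)) (ℕ.pred-mono-≤ 2≤mₚ))
  ... | no  i≢p  = a≢b i (inj₁ i≢p)

  Covers : (xs ys : Vec ℕ n) → Set
  Covers xs ys = ∀ k → lookup m k ≤ lookup xs k + lookup ys k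

  -- At coordinate i the sum is 0 + (mᵢ - 1).
  ¬covers-ab : ∀ i → ¬ Covers (a i) (b i)
  ¬covers-ab i cov = ℕ.<⇒≱ (bᵢ<m i) (respʳ _≤_ (cong (_+ lookup (b i) i) (aᵢ[i] i)) (cov i))

  full⇒covers : ∀ {xs ys} → (∀ k → lookup xs k ≡ lookup m k ⊎ lookup ys k ≡ lookup m k) → Covers xs ys
  full⇒covers {xs} {ys} full k with full k
  ... | inj₁ x≡m = respˡ _≤_ x≡m (ℕ.m≤m+n (lookup xs k) (lookup ys k))
  ... | inj₂ y≡m = respˡ _≤_ y≡m (ℕ.m≤n+m (lookup ys k) (lookup xs k))

  covers-aa : ∀ {i j} → i ≢ j → Covers (a i) (a j)
  covers-aa {i} {j} i≢j = full⇒covers {a i} {a j} full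
    where
    full : ∀ k → lookup (a i) k ≡ lookup m k ⊎ lookup (a j) k ≡ lookup m k
    full k with k Fin.≟ i
    ... | yes refl = inj₂ (aᵢ[k] i≢j)
    ... | no  k≢i  = inj₁ (aᵢ[k] k≢i)

  -- `a i` falls short of m only at i, where `b j` is full because i is neither j nor p.
  covers-ab : ∀ {i j} → i ≢ p → i ≢ j → Covers (a i) (b j)
  covers-ab {i} {j} i≢p i≢j = full⇒covers {a i} {b j} full
    where
    full : ∀ k → lookup (a i) k ≡ lookup m k ⊎ lookup (b j) k ≡ lookup m k
    full k with k Fin.≟ i
    ... | yes refl = inj₂ (bᵢ[k] i≢j i≢p)
    ... | no  k≢i  = inj₁ (aᵢ[k] k≢i)

  -- Off p the vector `b p` is full; at p the claim is mₚ ≤ 2(mₚ - 1), that is, mₚ ≥ 2.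
  covers-bbₚ : ∀ i → 2 ≤ lookup m p → Covers (b i) (b p)
  covers-bbₚ i 2≤mₚ k with k Fin.≟ p
  ... | yes refl = respʳ _≤_ (sym (cong₂ _+_ (bᵢ[p] i) (bᵢ[p] p))) (≤pred+pred 2≤mₚ)
    where
    ≤pred+pred : ∀ {x} → 2 ≤ x → x ≤ pred x + pred x
    ≤pred+pred {suc (suc x)} (s≤s (s≤s _)) = s≤s (ℕ.m≤n+m (suc x) x)
  ... | no  k≢p  = respʳ _≤_ (cong (lookup (b i) k +_) (sym (bᵢ[k] k≢p k≢p))) (ℕ.m≤n+m (lookup m k) (lookup (b i) k))

  aᵢ≢aⱼ : ∀ {i j} → i ≢ j → a i ≢ a j
  aᵢ≢aⱼ {i} i≢j = ≢-at i (respʳ _<_ (sym (aᵢ[k] i≢j)) (aᵢ<m i))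

  aᵢ≢bⱼ : ∀ {i j} → i ≢ p → i ≢ j → a i ≢ b j
  aᵢ≢bⱼ {i} i≢p i≢j = ≢-at i (respʳ _<_ (sym (bᵢ[k] i≢j i≢p)) (aᵢ<m i))

  bᵢ≢bₚ : ∀ {i} → i ≢ p → b i ≢ b p
  bᵢ≢bₚ {i} i≢p = ≢-at i (respʳ _<_ (sym (bᵢ[k] i≢p i≢p)) (bᵢ<m i))

-- Lower bounds.

D-lower-bound : ∀ n (m : Vec ℕ (2 + n)) → (∀ i → 1 ≤ lookup m i) → (p : Fin (2 + n)) → 2 ≤ lookup m p →
  ∀ e → IsThresholdIntersection (D m) e → 2 + n ≤ e
D-lower-bound n m 1≤m p 2≤mₚ = conflict-bound (D m) A B
  (λ i → a≢b i (inj₂ 2≤mₚ) ∘ cong coords)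
  (λ i → ¬covers-ab i ∘ proj₂)
  conflict
  where
  open NonEdges m 1≤m p
  A B : Fin (2 + n) → Vertex m
  A i = aᵛ (Fin.punchInᵢ≢i i zero)
  B i = bᵛ {i} (subst (1 ≤_) (sym (bᵢ[p] i)) (ℕ.pred-mono-≤ 2≤mₚ))
  conflict : ∀ {i j} → i ≢ j → Conflict (D m) (A i) (B i) (A j) (B j)
  conflict {i} {j} i≢j with i Fin.≟ p | j Fin.≟ p
  -- At coordinate p, `a p` and `b i` total only mₚ - 1, so a conflict involving the pair at p has
  -- to match `a` with `a` and `b` with `b`.
  ... | _        | yes refl = inj₁
    ( (aᵢ≢aⱼ i≢j ∘ cong coords , covers-aa i≢j)
    , (bᵢ≢bₚ i≢j ∘ cong coords , covers-bbₚ i 2≤mₚ))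
  ... | yes refl | no j≢p   = inj₁
    ( (aᵢ≢aⱼ i≢j ∘ cong coords , covers-aa i≢j)
    , SimpleGraph.sym (D m) {B j} {B p} (bᵢ≢bₚ j≢p ∘ cong coords , covers-bbₚ j 2≤mₚ))
  ... | no i≢p   | no j≢p   = inj₂
    ( (aᵢ≢bⱼ i≢p i≢j ∘ cong coords , covers-ab i≢p i≢j)
    , SimpleGraph.sym (D m) {A j} {B i}
        (aᵢ≢bⱼ j≢p (≢-sym i≢j) ∘ cong coords , covers-ab j≢p (≢-sym i≢j)))

-- Here p is `zero`, and `a p` coincides with `b p`, so only the indices `suc i` give non-edges: one
-- fewer than the length of m.
D-𝟏-lower-bound : ∀ n e → IsThresholdIntersection (D (replicate (3 + n) 1)) e → 2 + n ≤ e
D-𝟏-lower-bound n = conflict-bound (D m) A B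
  (λ i → a≢b (suc i) (inj₁ λ ()) ∘ cong coords)
  (λ i → ¬covers-ab (suc i) ∘ proj₂)
  λ {i} {j} i≢j → inj₂
    ( (aᵢ≢bⱼ (λ ()) (i≢j ∘ Fin.suc-injective) ∘ cong coords
      , covers-ab (λ ()) (i≢j ∘ Fin.suc-injective))
    , SimpleGraph.sym (D m) {A j} {B i}
        (aᵢ≢bⱼ (λ ()) (≢-sym i≢j ∘ Fin.suc-injective) ∘ cong coords
        , covers-ab (λ ()) (≢-sym i≢j ∘ Fin.suc-injective)))
  where
  m = replicate (3 + n) 1
  1≤m : ∀ i → 1 ≤ lookup m i
  1≤m i = ℕ.≤-reflexive (sym (Vec.lookup-replicate i 1))
  open NonEdges m 1≤m zero
  A B : Fin (2 + n) → Vertex m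
  A i = aᵛ {suc i} {zero} λ ()
  -- `suc (punchIn i zero)` is a third coordinate, distinct from `zero` and `suc i`, where the entry
  -- is still 1.
  B i = bᵛ {suc i} {suc (punchIn i zero)}
    (subst (1 ≤_) (sym (bᵢ[k] (Fin.punchInᵢ≢i i zero ∘ Fin.suc-injective) λ ())) (1≤m (suc (punchIn i zero))))

-- Assembling the three cases.

all-1 : ∀ {n} (m : Vec ℕ n) → (∀ i → 1 ≤ lookup m i) → ¬ (∃[ i ] 2 ≤ lookup m i) → m ≡ replicate n 1
all-1 m 1≤m ∄2≤ = lookup-ext λ i →
  trans (ℕ.≤-antisym (s≤s⁻¹ (ℕ.≰⇒> (∄2≤ ∘ (i ,_)))) (1≤m i)) (sym (Vec.lookup-replicate i 1))

theorem43 : ∀ (n : ℕ) → 2 ≤ n → (m : Vec ℕ n) → (∀ i → 1 ≤ lookup m i) →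
    (m ≢ replicate n 1 → dim-TH D m ≔ n) ×
    (m ≡ replicate n 1 → n ≡ 2 → dim-TH D m ≔ 0) ×
    (m ≡ replicate n 1 → 3 ≤ n → dim-TH D m ≔ (n ∸ 1))
theorem43 (suc (suc n)) (s≤s (s≤s z≤n)) m 1≤m = general , (λ { refl refl → square }) , (λ { refl 3≤n → ones n 3≤n })
  where
  general : m ≢ replicate (2 + n) 1 → dim-TH D m ≔ (2 + n)
  general m≢𝟏 with Fin.any? (λ i → 2 ℕ.≤? lookup m i)
  ... | yes (p , 2≤mₚ) = D-threshold-intersection m , D-lower-bound n m 1≤m p 2≤mₚ
  ... | no  ∄2≤        = contradiction (all-1 m 1≤m ∄2≤) m≢𝟏
  square : dim-TH D (1 ∷ 1 ∷ []) ≔ 0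
  -- With no factors, the intersection condition says exactly that distinct vertices are adjacent.
  square = ((λ ()) , (λ ()) , λ v w v≢w → mk⇔ (λ _ ()) (λ _ → D-1-1-complete v≢w)) , λ _ _ → z≤n
  ones : ∀ n → 3 ≤ 2 + n → dim-TH D (replicate (2 + n) 1) ≔ (1 + n)
  ones (suc n) _ = D-𝟏-threshold-intersection (2 + n) , D-𝟏-lower-bound n
  ones zero (s≤s (s≤s ()))
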